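{- There is no edge-girth-regular graph with parameters $(v,4,4,4)$; that is, for every positive integer $v$, no $egr(v,4,4,4)$-graph exists.
   Context: Graphs are finite, simple and undirected. For integers $v,k,g,\lambda$, an $egr(v,k,g,\lambda)$-graph (edge-girth-regular graph) is a $k$-regular graph on $v$ vertices with girth $g$ (the length of a shortest cycle is exactly $g$) such that every edge is contained in exactly $\lambda$ cycles of length $g$. -}

module Defs where

open import Data.Fin using (Fin; toℕ)
open import Data.Nat using (ℕ; suc; _≤_)
open import Data.Nat.DivMod using (_mod_)
open import Data.Product using (Σ; ∃; _×_; _,_; proj₁)
open import Data.Sum using (_⊎_)
open import Function using (_∘_)
open import Function.Bundles using (Bijection)
open import Function.Definitions using (Injective)
open import Level using (0ℓ)
open import Relation.Binary.Bundles using (Setoid)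
open import Relation.Binary.Core using (Rel)
open import Relation.Binary.Definitions using (Decidable; Irreflexive; Symmetric)
open import Relation.Binary.PropositionalEquality using (_≡_; setoid)
open import Relation.Unary using (Pred)
open import Relation.Unary.Relation.Binary.Equality using (≐-setoid)
import Relation.Binary.Construct.On as On

-- S has exactly n elements, counted up to the equality of S.
HasSize : Setoid 0ℓ 0ℓ → ℕ → Set
HasSize S n = Bijection (setoid (Fin n)) S

record Graph (v : ℕ) : Set₁ where
  field
    Adj    : Rel (Fin v) 0ℓ
    adj?   : Decidable Adj
    sym    : Symmetric Adj
    irrefl : Irreflexive _≡_ Adj

-- The successor of i modulo n, so that the last index is followed by 0.
next : ∀ {n} → Fin n → Fin n
next {suc n} i = suc (toℕ i) mod suc n

module _ {v : ℕ} (G : Graph v) where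
  open Graph G

  -- Compared by the vertex alone: Adj need not be proof-irrelevant.
  Neighbours : Fin v → Setoid 0ℓ 0ℓ
  Neighbours x = On.setoid {B = Σ (Fin v) (Adj x)} (setoid (Fin v)) proj₁

  Regular : ℕ → Set
  Regular k = ∀ x → HasSize (Neighbours x) k

  record Cycle (l : ℕ) : Set where
    field
      3≤l      : 3 ≤ l
      vertex   : Fin l → Fin v
      distinct : Injective _≡_ _≡_ vertex
      adjacent : ∀ i → Adj (vertex i) (vertex (next i))

  edges : ∀ {l} → Cycle l → Pred (Fin v × Fin v) 0ℓ
  edges c (x , y) = ∃ λ i → (x ≡ vertex i × y ≡ vertex (next i))
                          ⊎ (y ≡ vertex i × x ≡ vertex (next i))
    where open Cycle c

  -- A Cycle carries a starting vertex and a direction. As subgraphs, two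
  -- cycles are the same when they have the same edges.
  CyclesThrough : ℕ → Fin v → Fin v → Setoid 0ℓ 0ℓ
  CyclesThrough l x y =
    On.setoid {B = Σ (Cycle l) λ c → edges c (x , y)}
              (≐-setoid (Fin v × Fin v) 0ℓ) (edges ∘ proj₁)

  HasGirth : ℕ → Set
  HasGirth g = Cycle g × (∀ {l} → Cycle l → g ≤ l)

record IsEGR {v : ℕ} (G : Graph v) (k g λ′ : ℕ) : Set where
  open Graph G
  field
    regular      : Regular G k
    girth        : HasGirth G g
    edge-regular : ∀ {x y} → Adj x y → HasSize (CyclesThrough G g x y) λ′

{-# OPTIONS --safe #-}
module Submission where

-- Let A be the adjacency matrix. Counting the walks of length 3 between the ends of an
-- edge a u, the 4 four-cycles and the 7 degenerate walks give A³ a u = 11.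
-- If A² u x = 1, with a the only common neighbour of u and x, then A³ a u + A³ a x = 22
-- is the sum of A² s u + A² s x over the 4 neighbours s of a; but each of these is at
-- most 5, as u and x share only a. So A² u x is never 1.
-- For fixed u, the row A² u has sum 16 and sum of squares 44. Without its diagonal entry 4
-- the sums are 12 and 28, which entries 0, 2, 3, 4 cannot realise: 28 - 2 * 12 = 4 is not
-- a sum of values b (b - 2), that is of values 0, 3, 8.

open import Data.Bool using (if_then_else_)
open import Data.Empty using (⊥)
open import Data.Fin using (Fin; zero; suc; toℕ; punchIn; _≟_)
open import Data.Fin.Patterns using (0F; 1F; 2F; 3F)
open import Data.Fin.Properties using (all?; any?; punchInᵢ≢i)
open import Data.Nat using (ℕ; zero; suc; NonZero; _+_; _*_; _∸_; _≤_; z≤n; s≤s)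
open import Data.Nat.DivMod using (_mod_)
open import Data.Nat.Properties hiding (_≟_)
open import Data.Nat.Tactic.RingSolver using (solve-∀)
open import Data.Product using (∃; _×_; _,_; proj₁; proj₂; swap)
open import Data.Product.Properties using (≡-dec; ,-injective)
open import Data.Sum using (_⊎_; inj₁; inj₂; [_,_])
open import Data.Vec.Functional using (removeAt)
open import Defs
open import Function using (_∘_; case_of_)
open import Function.Bundles using (Bijection)
open import Function.Definitions using (Injective)
open import Relation.Binary.Definitions using (DecidableEquality)
open import Relation.Binary.PropositionalEquality hiding ([_])
open import Relation.Nullary using (¬_; Dec; yes; no; does; contradiction)
open import Relation.Nullary.Decidable using (_×-dec_; _→-dec_; ¬?; dec-true; dec-false; from-yes)
open import Relation.Unary using (Pred; _⊆_; _≐_)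

open import Algebra.Properties.Semiring.Sum +-*-semiring

-- Finite sums of naturals

sum-mono : ∀ {n} {f g : Fin n → ℕ} → (∀ i → f i ≤ g i) → sum f ≤ sum g
sum-mono {zero}  f≤g = z≤n
sum-mono {suc n} f≤g = +-mono-≤ (f≤g zero) (sum-mono (f≤g ∘ suc))

sum-zero : ∀ {n} {f : Fin n → ℕ} → (∀ i → f i ≡ 0) → sum f ≡ 0
sum-zero {zero}  f≡0 = refl
sum-zero {suc n} f≡0 = cong₂ _+_ (f≡0 zero) (sum-zero (f≡0 ∘ suc))

sum≡0⇒≡0 : ∀ {n} (f : Fin n → ℕ) → sum f ≡ 0 → ∀ i → f i ≡ 0
sum≡0⇒≡0 f s zero    = m+n≡0⇒m≡0 (f zero) s
sum≡0⇒≡0 f s (suc i) = sum≡0⇒≡0 (f ∘ suc) (m+n≡0⇒n≡0 (f zero) s) i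

sum-nonzero : ∀ {n} (f : Fin n → ℕ) → sum f ≢ 0 → ∃ λ i → f i ≢ 0
sum-nonzero {zero}  f s≢0 = contradiction refl s≢0
sum-nonzero {suc n} f s≢0 with f zero in eq
... | suc m = zero , λ f0≡0 → case trans (sym eq) f0≡0 of λ ()
... | zero  with sum-nonzero (f ∘ suc) s≢0
...   | i , fi≢0 = suc i , fi≢0

sum-ones : ∀ n → ∑[ i < n ] 1 ≡ n
sum-ones zero    = refl
sum-ones (suc n) = cong suc (sum-ones n)

sum-support : ∀ {n} (f : Fin n → ℕ) i → (∀ j → j ≢ i → f j ≡ 0) → sum f ≡ f i
sum-support {suc n} f i f≡0 = begin
  sum f                      ≡⟨ sum-remove {i = i} f ⟩
  f i + sum (removeAt f i)   ≡⟨ cong (f i +_) (sum-zero λ j → f≡0 (punchIn i j) (punchInᵢ≢i i j)) ⟩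
  f i + 0                    ≡⟨ +-identityʳ (f i) ⟩
  f i                        ∎
  where open ≡-Reasoning

sum-closed : ∀ {p} (P : Pred ℕ p) → P 0 → (∀ {a b} → P a → P b → P (a + b)) →
             ∀ {n} (f : Fin n → ℕ) → (∀ i → P (f i)) → P (sum f)
sum-closed P p0 p+ {zero}  f pf = p0
sum-closed P p0 p+ {suc n} f pf = p+ (pf zero) (sum-closed P p0 p+ (f ∘ suc) (pf ∘ suc))

-- Indicators and counting

⟦_⟧ : ∀ {p} {P : Set p} → Dec P → ℕ
⟦ P? ⟧ = if does P? then 1 else 0

module _ {p} {P : Set p} where

  ⟦⟧-true : (P? : Dec P) → P → ⟦ P? ⟧ ≡ 1
  ⟦⟧-true P? p = cong (if_then 1 else 0) (dec-true P? p)

  ⟦⟧-false : (P? : Dec P) → ¬ P → ⟦ P? ⟧ ≡ 0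
  ⟦⟧-false P? ¬p = cong (if_then 1 else 0) (dec-false P? ¬p)

  ⟦⟧≤1 : (P? : Dec P) → ⟦ P? ⟧ ≤ 1
  ⟦⟧≤1 (yes _) = s≤s z≤n
  ⟦⟧≤1 (no _)  = z≤n

  ⟦⟧≡1⇒ : (P? : Dec P) → ⟦ P? ⟧ ≡ 1 → P
  ⟦⟧≡1⇒ (yes p) _ = p

⟦⟧-cong : ∀ {p q} {P : Set p} {Q : Set q} (P? : Dec P) (Q? : Dec Q) →
          (P → Q) → (Q → P) → ⟦ P? ⟧ ≡ ⟦ Q? ⟧
⟦⟧-cong (yes p) Q? to from = sym (⟦⟧-true Q? (to p))
⟦⟧-cong (no ¬p) Q? to from = sym (⟦⟧-false Q? (¬p ∘ from))

⟦⟧-× : ∀ {p q} {P : Set p} {Q : Set q} (P? : Dec P) (Q? : Dec Q) →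
       ⟦ P? ×-dec Q? ⟧ ≡ ⟦ P? ⟧ * ⟦ Q? ⟧
⟦⟧-× (yes _) (yes _) = refl
⟦⟧-× (yes _) (no _)  = refl
⟦⟧-× (no _)  _       = refl

sum-δ : ∀ {n} (u : Fin n) (f : Fin n → ℕ) → ∑[ x < n ] (⟦ u ≟ x ⟧ * f x) ≡ f u
sum-δ u f = begin
  sum (λ x → ⟦ u ≟ x ⟧ * f x)  ≡⟨ sum-support _ u (λ x x≢u → cong (_* f x) (⟦⟧-false (u ≟ x) (x≢u ∘ sym))) ⟩
  ⟦ u ≟ u ⟧ * f u              ≡⟨ cong (_* f u) (⟦⟧-true (u ≟ u) refl) ⟩
  1 * f u                      ≡⟨ *-identityˡ (f u) ⟩
  f u                          ∎
  where open ≡-Reasoning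

sum-indicator : ∀ {n} (u : Fin n) → ∑[ x < n ] ⟦ u ≟ x ⟧ ≡ 1
sum-indicator u = trans
  (sum-support _ u λ x x≢u → ⟦⟧-false (u ≟ x) (x≢u ∘ sym))
  (⟦⟧-true (u ≟ u) refl)

-- Counting a decidable set through an enumeration

module _ {k} {X : Set} (_≟ˣ_ : DecidableEquality X) {P : X → Set} (P? : ∀ x → Dec (P x))
         (f : Fin k → X) (f-injective : Injective _≡_ _≡_ f)
         (f-sound : ∀ i → P (f i)) (f-complete : ∀ {x} → P x → ∃ λ i → f i ≡ x) where

  -- Soundness kills every term on the right when `P x` fails. When it holds, completeness supplies
  -- an index for `x`, and injectivity leaves that term as the only nonzero one.
  indicator-image : ∀ x → ⟦ P? x ⟧ ≡ ∑[ i < k ] ⟦ f i ≟ˣ x ⟧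
  indicator-image x with P? x
  ... | no ¬Px = sym (sum-zero λ i → ⟦⟧-false (f i ≟ˣ x) λ { refl → ¬Px (f-sound i) })
  ... | yes Px with f-complete Px
  ...   | i , refl = sym (trans
            (sum-support _ i λ j j≢i → ⟦⟧-false (f j ≟ˣ f i) (j≢i ∘ f-injective))
            (⟦⟧-true (f i ≟ˣ f i) refl))

module _ {k n} {P : Fin n → Set} (P? : ∀ x → Dec (P x))
         (f : Fin k → Fin n) (f-injective : Injective _≡_ _≡_ f)
         (f-sound : ∀ i → P (f i)) (f-complete : ∀ {x} → P x → ∃ λ i → f i ≡ x) where

  count-image : ∑[ x < n ] ⟦ P? x ⟧ ≡ k
  count-image = begin
    sum (λ x → ⟦ P? x ⟧)                    ≡⟨ sum-cong-≗ (indicator-image _≟_ P? f f-injective f-sound f-complete) ⟩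
    sum (λ x → sum (λ i → ⟦ f i ≟ x ⟧))     ≡⟨ ∑-comm (λ x i → ⟦ f i ≟ x ⟧) ⟩
    sum (λ i → sum (λ x → ⟦ f i ≟ x ⟧))     ≡⟨ sum-cong-≗ (λ i → sum-indicator (f i)) ⟩
    sum {k} (λ i → 1)                       ≡⟨ sum-ones k ⟩
    k                                       ∎
    where open ≡-Reasoning

module _ {k m n} {P : Fin m × Fin n → Set} (P? : ∀ x → Dec (P x))
         (f : Fin k → Fin m × Fin n) (f-injective : Injective _≡_ _≡_ f)
         (f-sound : ∀ i → P (f i)) (f-complete : ∀ {x} → P x → ∃ λ i → f i ≡ x) where

  private
    _≟²_ : DecidableEquality (Fin m × Fin n)
    _≟²_ = ≡-dec _≟_ _≟_

  -- Double counting, as for a single index. The indicator of a pair factors into indicators of its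
  -- coordinates, so each enumerated pair contributes exactly 1 to the double sum.
  count-image² : ∑[ x < m ] ∑[ y < n ] ⟦ P? (x , y) ⟧ ≡ k
  count-image² = begin
    sum (λ x → sum (λ y → ⟦ P? (x , y) ⟧))
      ≡⟨ sum-cong-≗ (λ x → sum-cong-≗ λ y → indicator-image _≟²_ P? f f-injective f-sound f-complete (x , y)) ⟩
    sum (λ x → sum (λ y → sum (λ i → ⟦ f i ≟² (x , y) ⟧)))
      ≡⟨ sum-cong-≗ (λ x → ∑-comm (λ y i → ⟦ f i ≟² (x , y) ⟧)) ⟩
    sum (λ x → sum (λ i → sum (λ y → ⟦ f i ≟² (x , y) ⟧)))
      ≡⟨ ∑-comm (λ x i → sum (λ y → ⟦ f i ≟² (x , y) ⟧)) ⟩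
    sum (λ i → sum (λ x → sum (λ y → ⟦ f i ≟² (x , y) ⟧)))
      ≡⟨ sum-cong-≗ one ⟩
    sum {k} (λ i → 1)
      ≡⟨ sum-ones k ⟩
    k ∎
    where
    open ≡-Reasoning
    split : ∀ i x y → ⟦ f i ≟² (x , y) ⟧ ≡ ⟦ proj₁ (f i) ≟ x ⟧ * ⟦ proj₂ (f i) ≟ y ⟧
    split i x y = trans
      (⟦⟧-cong (f i ≟² (x , y)) (proj₁ (f i) ≟ x ×-dec proj₂ (f i) ≟ y)
               ,-injective λ (p , q) → cong₂ _,_ p q)
      (⟦⟧-× (proj₁ (f i) ≟ x) (proj₂ (f i) ≟ y))
    one : ∀ i → sum (λ x → sum (λ y → ⟦ f i ≟² (x , y) ⟧)) ≡ 1
    one i = begin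
      sum (λ x → sum (λ y → ⟦ f i ≟² (x , y) ⟧))
        ≡⟨ sum-cong-≗ (λ x → sum-cong-≗ (split i x)) ⟩
      sum (λ x → sum (λ y → ⟦ proj₁ (f i) ≟ x ⟧ * ⟦ proj₂ (f i) ≟ y ⟧))
        ≡⟨ sum-cong-≗ (λ x → *-distribˡ-sum ⟦ proj₁ (f i) ≟ x ⟧ (λ y → ⟦ proj₂ (f i) ≟ y ⟧)) ⟨
      sum (λ x → ⟦ proj₁ (f i) ≟ x ⟧ * sum (λ y → ⟦ proj₂ (f i) ≟ y ⟧))
        ≡⟨ sum-δ (proj₁ (f i)) _ ⟩
      sum (λ y → ⟦ proj₂ (f i) ≟ y ⟧)
        ≡⟨ sum-indicator (proj₂ (f i)) ⟩
      1 ∎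

-- Symmetric 0/1 matrices

≤1⇒≡0⊎≡1 : ∀ {m} → m ≤ 1 → m ≡ 0 ⊎ m ≡ 1
≤1⇒≡0⊎≡1 z≤n       = inj₁ refl
≤1⇒≡0⊎≡1 (s≤s z≤n) = inj₂ refl

m*n≡0⇒m+n≤1 : ∀ {m n} → m ≤ 1 → n ≤ 1 → m * n ≡ 0 → m + n ≤ 1
m*n≡0⇒m+n≤1 z≤n       n≤1 _ = n≤1
m*n≡0⇒m+n≤1 (s≤s z≤n) _   e = s≤s (≤-reflexive (trans (sym (+-identityʳ _)) e))

-- The size is a successor so that one index can be split off with `removeAt`, and so that a row
-- exists to be contradicted in the end.
module ZeroOneMatrix {n} (A : Fin (suc n) → Fin (suc n) → ℕ)
  (A≤1 : ∀ x y → A x y ≤ 1) (A-sym : ∀ x y → A x y ≡ A y x)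
  (row : ∀ x → ∑[ y < suc n ] A x y ≡ 4) where

  A² : Fin (suc n) → Fin (suc n) → ℕ
  A² x y = ∑[ z < suc n ] (A x z * A z y)

  A³ : Fin (suc n) → Fin (suc n) → ℕ
  A³ x y = ∑[ z < suc n ] (A x z * A² z y)

  open ≤-Reasoning

  A²-sym : ∀ x y → A² x y ≡ A² y x
  A²-sym x y = sum-cong-≗ λ z → trans (*-comm (A x z) (A z y)) (cong₂ _*_ (A-sym z y) (A-sym x z))

  sum-row-* : ∀ x c → ∑[ y < suc n ] (A x y * c) ≡ 4 * c
  sum-row-* x c = trans (sym (*-distribʳ-sum c (A x))) (cong (_* c) (row x))

  A-idem : ∀ x y → A x y * A x y ≡ A x y
  A-idem x y with ≤1⇒≡0⊎≡1 (A≤1 x y)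
  ... | inj₁ e rewrite e = refl
  ... | inj₂ e rewrite e = refl

  A²-diagonal : ∀ x → A² x x ≡ 4
  A²-diagonal x = begin-equality
    A² x x                     ≡⟨ sum-cong-≗ (λ z → cong (A x z *_) (A-sym z x)) ⟩
    sum (λ z → A x z * A x z)  ≡⟨ sum-cong-≗ (A-idem x) ⟩
    sum (A x)                  ≡⟨ row x ⟩
    4                          ∎

  A²≤4 : ∀ x y → A² x y ≤ 4
  A²≤4 x y = ≤-trans
    (sum-mono {g = A x} λ z → ≤-trans (*-monoʳ-≤ (A x z) (A≤1 z y)) (≤-reflexive (*-identityʳ _)))
    (≤-reflexive (row x))

  A²-row : ∀ x → ∑[ y < suc n ] A² x y ≡ 16
  A²-row x = begin-equality
    sum (λ y → sum (λ z → A x z * A z y))  ≡⟨ ∑-comm (λ y z → A x z * A z y) ⟩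
    sum (λ z → sum (λ y → A x z * A z y))  ≡⟨ sum-cong-≗ (λ z → trans (sym (*-distribˡ-sum (A x z) (A z))) (cong (A x z *_) (row z))) ⟩
    sum (λ z → A x z * 4)                  ≡⟨ sum-row-* x 4 ⟩
    16                                     ∎

  -- Consequences of the entries of `A³` on edges

  module _ (cube : ∀ x y → A x y ≡ 1 → A³ x y ≡ 11) where

    A²≢1 : ∀ u x → A² u x ≢ 1
    -- A nonzero term of the sum `A² u x` gives the common neighbour `a`. The contradiction is 22
    -- against 20 for `total`.
    A²≢1 u x A²≡1 with sum-nonzero (λ z → A u z * A z x) (λ s≡0 → case trans (sym A²≡1) s≡0 of λ ())
    ... | a , nz = <⇒≱ (from-yes (20 <? 22)) (subst (_≤ 20) total≡22 total≤20)
      where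
      ua : A u a ≡ 1
      ua with ≤1⇒≡0⊎≡1 (A≤1 u a)
      ... | inj₂ e = e
      ... | inj₁ e = contradiction (cong (_* A a x) e) nz

      ax : A a x ≡ 1
      ax with ≤1⇒≡0⊎≡1 (A≤1 a x)
      ... | inj₂ e = e
      ... | inj₁ e = contradiction (trans (cong (A u a *_) e) (*-zeroʳ (A u a))) nz

      -- `punchIn a` runs through the vertices other than `a`. As `a` already accounts for the whole
      -- of `A² u x`, the other terms vanish, so no such vertex is adjacent to both `u` and `x`.
      disjoint : ∀ j → let y = punchIn a j in A y u + A y x ≤ 1
      disjoint j = m*n≡0⇒m+n≤1 (A≤1 _ _) (A≤1 _ _)
        (trans (cong (_* A (punchIn a j) x) (A-sym _ u)) (sum≡0⇒≡0 (removeAt walks a) rest≡0 j))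
        where
        walks : Fin (suc n) → ℕ
        walks z = A u z * A z x
        rest≡0 : sum (removeAt walks a) ≡ 0
        rest≡0 = suc-injective (begin-equality
          1 + sum (removeAt walks a)        ≡⟨ cong (_+ sum (removeAt walks a)) (cong₂ _*_ ua ax) ⟨
          walks a + sum (removeAt walks a)  ≡⟨ sum-remove {i = a} walks ⟨
          sum walks                         ≡⟨ A²≡1 ⟩
          1                                 ∎)

      -- The vertex `a` can count twice among the neighbours of `s`, and every other vertex at most
      -- once. The bound is therefore the row sum 4 plus one extra `A s a`.
      A²+A²≤5 : ∀ s → A² s u + A² s x ≤ 5
      A²+A²≤5 s = begin
        A² s u + A² s x                               ≡⟨ ∑-distrib-+ (λ y → A s y * A y u) (λ y → A s y * A y x) ⟨
        sum (λ y → A s y * A y u + A s y * A y x)     ≡⟨ sum-cong-≗ (λ y → sym (*-distribˡ-+ (A s y) (A y u) (A y x))) ⟩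
        sum walks                                     ≡⟨ sum-remove {i = a} walks ⟩
        walks a + sum (removeAt walks a)              ≤⟨ +-mono-≤
                                                           (*-monoʳ-≤ (A s a) (+-mono-≤ (A≤1 a u) (A≤1 a x)))
                                                           (sum-mono λ j → *-monoʳ-≤ (A s (punchIn a j)) (disjoint j)) ⟩
        A s a * 2 + sum (λ j → removeAt (A s) a j * 1)  ≡⟨ cong₂ _+_ (double (A s a)) (sum-cong-≗ {x = λ j → removeAt (A s) a j * 1} λ j → *-identityʳ (removeAt (A s) a j)) ⟩
        A s a + A s a + sum (removeAt (A s) a)        ≡⟨ +-assoc (A s a) (A s a) _ ⟩
        A s a + (A s a + sum (removeAt (A s) a))      ≡⟨ cong (A s a +_) (sum-remove {i = a} (A s)) ⟨
        A s a + sum (A s)                             ≡⟨ cong (A s a +_) (row s) ⟩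
        A s a + 4                                     ≤⟨ +-monoˡ-≤ 4 (A≤1 s a) ⟩
        5                                             ∎
        where
        walks : Fin (suc n) → ℕ
        walks y = A s y * (A y u + A y x)
        double : ∀ m → m * 2 ≡ m + m
        double = solve-∀

      total : ℕ
      total = ∑[ s < suc n ] (A a s * (A² s u + A² s x))

      total≡22 : total ≡ 22
      total≡22 = begin-equality
        total                                              ≡⟨ sum-cong-≗ (λ s → *-distribˡ-+ (A a s) (A² s u) (A² s x)) ⟩
        sum (λ s → A a s * A² s u + A a s * A² s x)        ≡⟨ ∑-distrib-+ (λ s → A a s * A² s u) (λ s → A a s * A² s x) ⟩
        A³ a u + A³ a x                                    ≡⟨ cong₂ _+_ (cube a u (trans (A-sym a u) ua)) (cube a x ax) ⟩
        22                                                 ∎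

      total≤20 : total ≤ 20
      total≤20 = ≤-trans (sum-mono λ s → *-monoʳ-≤ (A a s) (A²+A²≤5 s)) (≤-reflexive (sum-row-* a 5))

    -- Opening one factor at its middle vertex `z` and summing over `x` first leaves
    -- `A u z * A³ z u`. The 4 neighbours `z` of `u` contribute 11 each.
    sum-A²-squares : ∀ u → ∑[ x < suc n ] (A² u x * A² u x) ≡ 44
    sum-A²-squares u = begin-equality
      sum (λ x → A² u x * A² u x)
        ≡⟨ sum-cong-≗ (λ x → *-distribʳ-sum (A² u x) (λ z → A u z * A z x)) ⟩
      sum (λ x → sum (λ z → A u z * A z x * A² u x))
        ≡⟨ ∑-comm (λ x z → A u z * A z x * A² u x) ⟩
      sum (λ z → sum (λ x → A u z * A z x * A² u x))
        ≡⟨ sum-cong-≗ (λ z → trans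
             (sum-cong-≗ λ x → trans (*-assoc (A u z) (A z x) (A² u x)) (cong (λ b → A u z * (A z x * b)) (A²-sym u x)))
             (sym (*-distribˡ-sum (A u z) (λ x → A z x * A² x u)))) ⟩
      sum (λ z → A u z * A³ z u)
        ≡⟨ sum-cong-≗ on-edges ⟩
      sum (λ z → A u z * 11)
        ≡⟨ sum-row-* u 11 ⟩
      44 ∎
      where
      on-edges : ∀ z → A u z * A³ z u ≡ A u z * 11
      on-edges z with ≤1⇒≡0⊎≡1 (A≤1 u z)
      ... | inj₁ e rewrite e = refl
      ... | inj₂ e = cong (A u z *_) (cube z u (trans (A-sym z u) e))

    impossible : ⊥
    impossible = four-bad (subst ZeroOrThreeOrLarge rest≡4
      (sum-closed ZeroOrThreeOrLarge (inj₁ refl) closed _ (λ j → excess-values (A²≤4 _ _) (A²≢1 u (punchIn u j)))))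
      where
      u : Fin (suc n)
      u = zero

      -- A set closed under addition that contains 0, 3 and 8 but not 4. The threshold 6 is 3 + 3.
      ZeroOrThreeOrLarge : ℕ → Set
      ZeroOrThreeOrLarge m = m ≡ 0 ⊎ m ≡ 3 ⊎ 6 ≤ m

      four-bad : ¬ ZeroOrThreeOrLarge 4
      four-bad (inj₂ (inj₂ (s≤s (s≤s (s≤s (s≤s ()))))))

      closed : ∀ {a b} → ZeroOrThreeOrLarge a → ZeroOrThreeOrLarge b → ZeroOrThreeOrLarge (a + b)
      closed (inj₁ refl)        q                  = q
      closed (inj₂ (inj₁ refl)) (inj₁ refl)        = inj₂ (inj₁ refl)
      closed (inj₂ (inj₁ refl)) (inj₂ (inj₁ refl)) = inj₂ (inj₂ ≤-refl)
      closed (inj₂ (inj₁ refl)) (inj₂ (inj₂ 6≤b))  = inj₂ (inj₂ (≤-trans 6≤b (m≤n+m _ 3)))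
      closed (inj₂ (inj₂ 6≤a))  _                  = inj₂ (inj₂ (≤-trans 6≤a (m≤m+n _ _)))

      excess : ℕ → ℕ
      excess b = b * (b ∸ 2)

      excess-values : ∀ {b} → b ≤ 4 → b ≢ 1 → ZeroOrThreeOrLarge (excess b)
      excess-values {0} _ _   = inj₁ refl
      excess-values {1} _ b≢1 = contradiction refl b≢1
      excess-values {2} _ _   = inj₁ refl
      excess-values {3} _ _   = inj₂ (inj₁ refl)
      excess-values {4} _ _   = inj₂ (inj₂ (from-yes (6 ≤? 8)))
      excess-values {suc (suc (suc (suc (suc _))))} (s≤s (s≤s (s≤s (s≤s ())))) _

      -- The truncated subtraction in `excess` is harmless at 0, where the factor `b` vanishes, but
      -- breaks the identity at 1; this is where `A²≢1` enters the sum.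
      square-excess : ∀ b → b ≢ 1 → b * b ≡ excess b + b * 2
      square-excess 0             _   = refl
      square-excess 1             b≢1 = contradiction refl b≢1
      square-excess (suc (suc m)) _   = trans (cong (suc (suc m) *_) (+-comm 2 m)) (*-distribˡ-+ (suc (suc m)) m 2)

      sum-excess : ∑[ x < suc n ] excess (A² u x) ≡ 12
      -- 32 is twice the row sum 16. It is added to both sides rather than subtracted from 44.
      sum-excess = +-cancelʳ-≡ 32 _ _ (begin-equality
        sum (λ x → excess (A² u x)) + 32
          ≡⟨ cong (λ s → sum (λ x → excess (A² u x)) + s * 2) (A²-row u) ⟨
        sum (λ x → excess (A² u x)) + sum (A² u) * 2
          ≡⟨ cong (sum (λ x → excess (A² u x)) +_) (*-distribʳ-sum 2 (A² u)) ⟩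
        sum (λ x → excess (A² u x)) + sum (λ x → A² u x * 2)
          ≡⟨ ∑-distrib-+ (λ x → excess (A² u x)) (λ x → A² u x * 2) ⟨
        sum (λ x → excess (A² u x) + A² u x * 2)
          ≡⟨ sum-cong-≗ (λ x → square-excess (A² u x) (A²≢1 u x)) ⟨
        sum (λ x → A² u x * A² u x)
          ≡⟨ sum-A²-squares u ⟩
        44 ∎)

      rest≡4 : sum (removeAt (λ x → excess (A² u x)) u) ≡ 4
      -- 8 is the excess of the diagonal entry 4.
      rest≡4 = +-cancelˡ-≡ 8 _ _ (begin-equality
        8 + rest                  ≡⟨ cong (λ b → excess b + rest) (A²-diagonal u) ⟨
        excess (A² u u) + rest    ≡⟨ sum-remove {i = u} (λ x → excess (A² u x)) ⟨
        sum (λ x → excess (A² u x)) ≡⟨ sum-excess ⟩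
        12                        ∎)
        where rest = sum (removeAt (λ x → excess (A² u x)) u)

-- Four-cycles

-- The eight symmetries of a square: `rotate i` sends 0, 1 to `i`, `next i`, and `reflect i` sends
-- them to `next i`, `i`. The constant 5 is 1 modulo 4, large enough to keep the subtraction from
-- truncating.
rotate reflect : Fin 4 → Fin 4 → Fin 4
rotate  i j = (toℕ i + toℕ j) mod 4
reflect i j = (5 + toℕ i ∸ toℕ j) mod 4

next-injective : ∀ (i j : Fin 4) → next i ≡ next j → i ≡ j
next-injective = from-yes (all? {4} λ i → all? λ j → (next i ≟ next j) →-dec (i ≟ j))

next-surjective : ∀ (i : Fin 4) → ∃ λ j → next j ≡ i
next-surjective = from-yes (all? λ i → any? {4} λ j → next j ≟ i)

-- The two alternatives of `direction` are preserved and reversed orientation. The second is phrased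
-- with `next` alone, which avoids a predecessor function.
record IsDihedral (σ : Fin 4 → Fin 4) : Set where
  field
    injective  : ∀ i j → σ i ≡ σ j → i ≡ j
    surjective : ∀ i → ∃ λ j → σ j ≡ i
    direction  : (∀ j → next (σ j) ≡ σ (next j)) ⊎ (∀ j → next (σ (next j)) ≡ σ j)

rotate-isDihedral : ∀ i → IsDihedral (rotate i)
rotate-isDihedral i = record
  { injective  = from-yes (all? λ i → all? λ j → all? λ k → (rotate i j ≟ rotate i k) →-dec (j ≟ k)) i
  ; surjective = from-yes (all? λ i → all? λ k → any? λ j → rotate i j ≟ k) i
  ; direction  = inj₁ (from-yes (all? λ i → all? λ j → next (rotate i j) ≟ rotate i (next j)) i)
  }

reflect-isDihedral : ∀ i → IsDihedral (reflect i)
reflect-isDihedral i = record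
  { injective  = from-yes (all? λ i → all? λ j → all? λ k → (reflect i j ≟ reflect i k) →-dec (j ≟ k)) i
  ; surjective = from-yes (all? λ i → all? λ k → any? λ j → reflect i j ≟ k) i
  ; direction  = inj₂ (from-yes (all? λ i → all? λ j → next (reflect i (next j)) ≟ reflect i j) i)
  }

module FourCycles {v} (G : Graph v) where

  open Graph G renaming (sym to adj-sym)
  open Cycle

  adj⇒≢ : ∀ {x y} → Adj x y → x ≢ y
  adj⇒≢ xy x≡y = irrefl x≡y xy

  module _ (c : Cycle G 4) {σ : Fin 4 → Fin 4} (dihedral : IsDihedral σ) where

    open IsDihedral dihedral

    relabel : Cycle G 4
    relabel = record
      { 3≤l      = 3≤l c
      ; vertex   = vertex c ∘ σ
      ; distinct = λ e → injective _ _ (distinct c e)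
      ; adjacent = adjacent′ direction
      }
      where
      adjacent′ : _ → ∀ i → Adj (vertex c (σ i)) (vertex c (σ (next i)))
      adjacent′ (inj₁ fwd) i = subst (λ k → Adj (vertex c (σ i)) (vertex c k)) (fwd i) (adjacent c (σ i))
      adjacent′ (inj₂ bwd) i = adj-sym
        (subst (λ k → Adj (vertex c (σ (next i))) (vertex c k)) (bwd i) (adjacent c (σ (next i))))

    edges-relabel : edges G c ≐ edges G relabel
    edges-relabel = to direction , from direction
      where
      to : _ → edges G c ⊆ edges G relabel
      to (inj₁ fwd) (k , e) with surjective k
      ... | j , refl rewrite fwd j = j , e
      -- Reversal shifts the index by one: the edge of `c` leaving `σ (next j)` is the edge of
      -- `relabel` at `j` with its ends swapped. Hence the preimage of `k` must itself be written as
      -- `next j`.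
      to (inj₂ bwd) (k , e) with surjective k
      ... | j′ , refl with next-surjective j′
      ...   | j , refl rewrite bwd j = j , [ inj₂ ∘ swap , inj₁ ∘ swap ] e
      from : _ → edges G relabel ⊆ edges G c
      from (inj₁ fwd) (j , e) rewrite sym (fwd j) = σ j , e
      from (inj₂ bwd) (j , e) rewrite sym (bwd j) = σ (next j) , [ inj₂ ∘ swap , inj₁ ∘ swap ] e

  -- Cycles based at a directed edge

  StartsWith : Fin v → Fin v → Cycle G 4 → Set
  StartsWith u a c = vertex c 0F ≡ u × vertex c 1F ≡ a

  -- If `c` passes from `u` to `a` a rotation brings that edge to the front, otherwise a reflection
  -- does. This removes the choice of start and direction, which the equality of cycles ignores.
  rebase : ∀ {u a} (c : Cycle G 4) → edges G c (u , a) →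
           ∃ λ c′ → StartsWith u a c′ × edges G c ≐ edges G c′
  rebase c (i , inj₁ (refl , refl)) =
    relabel c (rotate-isDihedral i) ,
    ( cong (vertex c) (from-yes (all? λ i → rotate i 0F ≟ i) i)
    , cong (vertex c) (from-yes (all? λ i → rotate i 1F ≟ next i) i)) ,
    edges-relabel c (rotate-isDihedral i)
  rebase c (i , inj₂ (refl , refl)) =
    relabel c (reflect-isDihedral i) ,
    ( cong (vertex c) (from-yes (all? λ i → reflect i 0F ≟ next i) i)
    , cong (vertex c) (from-yes (all? λ i → reflect i 1F ≟ i) i)) ,
    edges-relabel c (reflect-isDihedral i)

  same-vertices : ∀ {c c′ : Cycle G 4} → (∀ i → vertex c i ≡ vertex c′ i) → edges G c ⊆ edges G c′
  same-vertices eq (i , inj₁ (p , q)) = i , inj₁ (trans p (eq i) , trans q (eq (next i)))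
  same-vertices eq (i , inj₂ (p , q)) = i , inj₂ (trans p (eq i) , trans q (eq (next i)))

  -- Distinctness fixes the position of `p` on the cycle, so an edge at `p` leads to its predecessor
  -- or its successor. Writing the position as `next i` gives the predecessor the index `i`.
  edge-at : ∀ (c : Cycle G 4) i {p q} → p ≡ vertex c (next i) → edges G c (p , q) →
            q ≡ vertex c i ⊎ q ≡ vertex c (next (next i))
  edge-at c i refl (k , inj₁ (p , refl)) = inj₂ (cong (vertex c ∘ next) (sym (distinct c p)))
  edge-at c i refl (k , inj₂ (refl , p)) = inj₁ (cong (vertex c) (next-injective k i (sym (distinct c p))))

  -- The edge of `c` from `a` to its third vertex lies in `c′`, where `a` is joined only to `u` and
  -- the third vertex; `u` is ruled out by distinctness in `c`. The fourth vertex is found likewise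
  -- from the edges at `u`.
  same-edges : ∀ {u a} {c c′ : Cycle G 4} → StartsWith u a c → StartsWith u a c′ →
               edges G c ⊆ edges G c′ → vertex c 2F ≡ vertex c′ 2F × vertex c 3F ≡ vertex c′ 3F
  same-edges {c = c} {c′} (refl , refl) (u≡ , a≡) sub = third , fourth
    where
    third : vertex c 2F ≡ vertex c′ 2F
    third with edge-at c′ 0F (sym a≡) (sub (1F , inj₁ (refl , refl)))
    ... | inj₂ e = e
    ... | inj₁ e = case distinct c (trans e u≡) of λ ()
    fourth : vertex c 3F ≡ vertex c′ 3F
    fourth with edge-at c′ 3F (sym u≡) (sub (3F , inj₂ (refl , refl)))
    ... | inj₁ e = e
    ... | inj₂ e = case distinct c (trans e a≡) of λ ()

  -- Squares on an edge

  module _ (u a : Fin v) (ua : Adj u a) where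

    -- Only opposite corners need an explicit inequality, since adjacent ones differ by
    -- irreflexivity. The inequalities are grouped apart so that the indicator factors into them and
    -- a product of matrix entries.
    Square : Fin v × Fin v → Set
    Square (x , y) = (¬ u ≡ x × ¬ a ≡ y) × (Adj a x × Adj x y × Adj y u)

    square? : ∀ p → Dec (Square p)
    square? (x , y) = (¬? (u ≟ x) ×-dec ¬? (a ≟ y)) ×-dec (adj? a x ×-dec adj? x y ×-dec adj? y u)

    squareCycle : ∀ {p} → Square p → Cycle G 4
    squareCycle {x , y} ((u≢x , a≢y) , (ax , xy , yu)) = record
      { 3≤l      = s≤s (s≤s (s≤s z≤n))
      ; vertex   = corner
      ; distinct = corner-injective _ _
      ; adjacent = corner-adjacent
      }
      where
      corner : Fin 4 → Fin v
      corner 0F = u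
      corner 1F = a
      corner 2F = x
      corner 3F = y
      corner-adjacent : ∀ i → Adj (corner i) (corner (next i))
      corner-adjacent 0F = ua
      corner-adjacent 1F = ax
      corner-adjacent 2F = xy
      corner-adjacent 3F = yu
      corner-injective : ∀ i j → corner i ≡ corner j → i ≡ j
      corner-injective 0F 0F _ = refl
      corner-injective 0F 1F e = contradiction e (adj⇒≢ ua)
      corner-injective 0F 2F e = contradiction e u≢x
      corner-injective 0F 3F e = contradiction (sym e) (adj⇒≢ yu)
      corner-injective 1F 0F e = contradiction (sym e) (adj⇒≢ ua)
      corner-injective 1F 1F _ = refl
      corner-injective 1F 2F e = contradiction e (adj⇒≢ ax)
      corner-injective 1F 3F e = contradiction e a≢y
      corner-injective 2F 0F e = contradiction (sym e) u≢x
      corner-injective 2F 1F e = contradiction (sym e) (adj⇒≢ ax)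
      corner-injective 2F 2F _ = refl
      corner-injective 2F 3F e = contradiction e (adj⇒≢ xy)
      corner-injective 3F 0F e = contradiction e (adj⇒≢ yu)
      corner-injective 3F 1F e = contradiction (sym e) a≢y
      corner-injective 3F 2F e = contradiction (sym e) (adj⇒≢ xy)
      corner-injective 3F 3F _ = refl

    far-side : Cycle G 4 → Fin v × Fin v
    far-side c = vertex c 2F , vertex c 3F

    far-side-square : ∀ c → StartsWith u a c → Square (far-side c)
    far-side-square c (refl , refl) =
      ((λ e → case distinct c e of λ ()) , (λ e → case distinct c e of λ ())) ,
      (adjacent c 1F , adjacent c 2F , adjacent c 3F)

    -- Rebasing a cycle at `u`, `a` and reading off its last two vertices turns the enumeration of
    -- cycles into one of squares. Equal far sides give equal edge sets, hence equal indices.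
    count-squares : ∀ {k} → HasSize (CyclesThrough G 4 u a) k →
                    ∑[ x < v ] ∑[ y < v ] ⟦ square? (x , y) ⟧ ≡ k
    count-squares {k} size = count-image² square? (far-side ∘ based) injective′
                               (λ i → far-side-square (based i) (based-starts i)) complete
      where
      open Bijection size using (to; injective; strictlySurjective)
      rebased : ∀ i → _
      rebased i = rebase (proj₁ (to i)) (proj₂ (to i))
      based : Fin k → Cycle G 4
      based i = proj₁ (rebased i)
      based-starts : ∀ i → StartsWith u a (based i)
      based-starts i = proj₁ (proj₂ (rebased i))
      based-edges : ∀ i → edges G (proj₁ (to i)) ≐ edges G (based i)
      based-edges i = proj₂ (proj₂ (rebased i))

      injective′ : Injective _≡_ _≡_ (far-side ∘ based)
      injective′ {i} {j} e = injective (sub i j agree , sub j i (sym ∘ agree))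
        where
        agree : ∀ k → vertex (based i) k ≡ vertex (based j) k
        agree 0F = trans (proj₁ (based-starts i)) (sym (proj₁ (based-starts j)))
        agree 1F = trans (proj₂ (based-starts i)) (sym (proj₂ (based-starts j)))
        agree 2F = cong proj₁ e
        agree 3F = cong proj₂ e
        sub : ∀ i j → (∀ k → vertex (based i) k ≡ vertex (based j) k) →
              edges G (proj₁ (to i)) ⊆ edges G (proj₁ (to j))
        sub i j eq p = proj₂ (based-edges j) (same-vertices {based i} {based j} eq (proj₁ (based-edges i) p))

      complete : ∀ {p} → Square p → ∃ λ i → far-side (based i) ≡ p
      -- Surjectivity only yields a cycle with the same edges as `squareCycle sq`; `same-edges`
      -- turns this into equality of far sides.
      complete sq with strictlySurjective (squareCycle sq , 0F , inj₁ (refl , refl))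
      ... | i , sub , _ with same-edges {c = based i} {squareCycle sq} (based-starts i) (refl , refl)
                               (λ p → sub (proj₂ (based-edges i) p))
      ...   | x≡ , y≡ = i , cong₂ _,_ x≡ y≡

-- The walks of length 3 from a to a neighbour u are the squares on the edge together
-- with the degenerate walks a u y u and a x a u, where a u a u is of both kinds.
module AdjacencyMatrix {v} (G : Graph v) where

  open Graph G renaming (sym to adj-sym)
  open FourCycles G
  open ≡-Reasoning

  A : Fin v → Fin v → ℕ
  A x y = ⟦ adj? x y ⟧

  A-sym : ∀ x y → A x y ≡ A y x
  A-sym x y = ⟦⟧-cong (adj? x y) (adj? y x) adj-sym adj-sym

  A-row : ∀ {k} → Regular G k → ∀ x → ∑[ y < v ] A x y ≡ k
  A-row regular x = count-image (adj? x) (proj₁ ∘ to) injective (proj₂ ∘ to)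
    λ xy → let i , e = strictlySurjective (_ , xy) in i , e
    where open Bijection (regular x)

  -- Inclusion-exclusion at each pair `x`, `y`. The extra term on the left balances the walk a u a
  -- u, counted in both degenerate families on the right, and keeps the identity free of
  -- subtraction.
  walk : ∀ {u a} (ua : Adj u a) x y →
         A a x * (A x y * A y u) + ⟦ u ≟ x ⟧ * ⟦ a ≟ y ⟧ ≡
         ⟦ square? u a ua (x , y) ⟧ + (⟦ u ≟ x ⟧ * A u y + ⟦ a ≟ y ⟧ * A a x)
  walk {u} {a} ua x y = trans main (cong (_+ (⟦ u ≟ x ⟧ * A u y + ⟦ a ≟ y ⟧ * A a x)) (sym square-product))
    where
    square-product : ⟦ square? u a ua (x , y) ⟧ ≡
      ⟦ ¬? (u ≟ x) ×-dec ¬? (a ≟ y) ⟧ * (A a x * (A x y * A y u))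
    square-product = trans
      (⟦⟧-× (¬? (u ≟ x) ×-dec ¬? (a ≟ y)) (adj? a x ×-dec adj? x y ×-dec adj? y u))
      (cong (⟦ ¬? (u ≟ x) ×-dec ¬? (a ≟ y) ⟧ *_) (trans
        (⟦⟧-× (adj? a x) (adj? x y ×-dec adj? y u))
        (cong (A a x *_) (⟦⟧-× (adj? x y) (adj? y u)))))
    A-idem : ∀ x y → A x y * A y x ≡ A x y
    A-idem x y rewrite A-sym y x with adj? x y
    ... | yes _ = refl
    ... | no _  = refl
    Aua : A u a ≡ 1
    Aua = ⟦⟧-true (adj? u a) ua
    Aau : A a u ≡ 1
    Aau = ⟦⟧-true (adj? a u) (adj-sym ua)
    main : A a x * (A x y * A y u) + ⟦ u ≟ x ⟧ * ⟦ a ≟ y ⟧ ≡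
      ⟦ ¬? (u ≟ x) ×-dec ¬? (a ≟ y) ⟧ * (A a x * (A x y * A y u)) + (⟦ u ≟ x ⟧ * A u y + ⟦ a ≟ y ⟧ * A a x)
    -- With both equalities each side is 2. With exactly one, the product of three entries collapses
    -- to one entry, as going along an edge and back is idempotent. With neither, only the square
    -- term remains on the right.
    main with u ≟ x | a ≟ y
    ... | yes refl | yes refl rewrite Aua | Aau = refl
    ... | yes refl | no _     rewrite Aau | A-idem u y = solve₁ (A u y)
      where
      solve₁ : ∀ m → 1 * m + 0 ≡ 0 + (1 * m + 0)
      solve₁ = solve-∀
    ... | no _     | yes refl rewrite Aau | *-identityʳ (A x a) | A-idem a x = solve₂ (A a x)
      where
      solve₂ : ∀ m → m + 0 ≡ 0 + (0 + 1 * m)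
      solve₂ = solve-∀
    ... | no _     | no _     = solve₃ (A a x * (A x y * A y u))
      where
      solve₃ : ∀ m → m + 0 ≡ 1 * m + 0
      solve₃ = solve-∀

  -- Summing `walk` over all pairs gives `l` squares and `k` walks in each degenerate family. The 1
  -- on the left is the walk a u a u.
  count-walks : ∀ {k l u a} → Regular G k → (ua : Adj u a) → HasSize (CyclesThrough G 4 u a) l →
                ∑[ x < v ] (A a x * ∑[ y < v ] (A x y * A y u)) + 1 ≡ l + (k + k)
  count-walks {k} {l} {u} {a} regular ua size = begin
    sum (λ x → A a x * sum (λ y → A x y * A y u)) + 1
      ≡⟨ cong₂ _+_ (sum-cong-≗ λ x → *-distribˡ-sum (A a x) (λ y → A x y * A y u)) (sym corner) ⟩
    sum (λ x → sum (λ y → A a x * (A x y * A y u))) + sum (λ x → sum (λ y → ⟦ u ≟ x ⟧ * ⟦ a ≟ y ⟧))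
      ≡⟨ ∑∑-distrib-+ (λ x y → A a x * (A x y * A y u)) (λ x y → ⟦ u ≟ x ⟧ * ⟦ a ≟ y ⟧) ⟨
    sum (λ x → sum (λ y → A a x * (A x y * A y u) + ⟦ u ≟ x ⟧ * ⟦ a ≟ y ⟧))
      ≡⟨ sum-cong-≗ (λ x → sum-cong-≗ (walk ua x)) ⟩
    sum (λ x → sum (λ y → ⟦ square? u a ua (x , y) ⟧ + (⟦ u ≟ x ⟧ * A u y + ⟦ a ≟ y ⟧ * A a x)))
      ≡⟨ ∑∑-distrib-+ (λ x y → ⟦ square? u a ua (x , y) ⟧) (λ x y → ⟦ u ≟ x ⟧ * A u y + ⟦ a ≟ y ⟧ * A a x) ⟩
    sum (λ x → sum (λ y → ⟦ square? u a ua (x , y) ⟧)) + sum (λ x → sum (λ y → ⟦ u ≟ x ⟧ * A u y + ⟦ a ≟ y ⟧ * A a x))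
      ≡⟨ cong₂ _+_ (count-squares u a ua size) (∑∑-distrib-+ (λ x y → ⟦ u ≟ x ⟧ * A u y) (λ x y → ⟦ a ≟ y ⟧ * A a x)) ⟩
    l + (sum (λ x → sum (λ y → ⟦ u ≟ x ⟧ * A u y)) + sum (λ x → sum (λ y → ⟦ a ≟ y ⟧ * A a x)))
      ≡⟨ cong (l +_) (cong₂ _+_ (trans (factor (λ _ → A u)) (A-row regular u))
                                (trans (sum-cong-≗ λ x → sum-δ a (λ _ → A a x)) (A-row regular a))) ⟩
    l + (k + k) ∎
    where
    ∑∑-distrib-+ : ∀ (f g : Fin v → Fin v → ℕ) →
      sum (λ x → sum (λ y → f x y + g x y)) ≡ sum (λ x → sum (f x)) + sum (λ x → sum (g x))
    ∑∑-distrib-+ f g = trans (sum-cong-≗ λ x → ∑-distrib-+ (f x) (g x)) (∑-distrib-+ (sum ∘ f) (sum ∘ g))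
    factor : ∀ (f : Fin v → Fin v → ℕ) → sum (λ x → sum (λ y → ⟦ u ≟ x ⟧ * f x y)) ≡ sum (f u)
    factor f = trans (sum-cong-≗ λ x → sym (*-distribˡ-sum ⟦ u ≟ x ⟧ (f x))) (sum-δ u (sum ∘ f))
    corner : sum (λ x → sum (λ y → ⟦ u ≟ x ⟧ * ⟦ a ≟ y ⟧)) ≡ 1
    corner = trans (factor (λ _ y → ⟦ a ≟ y ⟧)) (sum-indicator a)

theorem1 : ∀ (v : ℕ) .{{_ : NonZero v}} (G : Graph v) → ¬ IsEGR G 4 4 4
theorem1 (suc n) G egr =
  -- The nested sum in `count-walks` unfolds to `A³ a u`. With `k` and `l` equal to 4 its right side
  -- is 12, that is 11 + 1, and the 1 cancels.
  impossible λ a u au → +-cancelʳ-≡ 1 _ _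
    (let ua = Graph.sym G (⟦⟧≡1⇒ (Graph.adj? G a u) au) in count-walks regular ua (edge-regular ua))
  where
  open IsEGR egr
  open AdjacencyMatrix G
  open ZeroOneMatrix A (λ x y → ⟦⟧≤1 (Graph.adj? G x y)) A-sym (A-row regular)
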